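{- For every coherence space $A$, one has $(\mathrm{flag}\,A)^{\perp}\equiv \mathrm{flag}(A^{\perp})$; that is, the coherence spaces $(\mathrm{flag}\,A)^{\perp}$ and $\mathrm{flag}(A^{\perp})$ have the same web and the same coherence relation.
   Context: A coherence space $A$ is a set $|A|$ (its web, possibly infinite, whose elements are called tokens) endowed with a reflexive and symmetric binary relation on $|A|$, called coherence and written $\alpha\sim\alpha'\,[A]$. Strict coherence $\alpha\frown\alpha'\,[A]$ means $\alpha\sim\alpha'\,[A]$ and $\alpha\neq\alpha'$. Since coherence is reflexive, a coherence space is determined by its web and its (symmetric, irreflexive) strict coherence relation. The negation $A^{\perp}$ has web $|A^\perp|=|A|$, and $\alpha\sim\alpha'\,[A^{\perp}]$ iff $\alpha=\alpha'$ or not $\alpha\sim\alpha'\,[A]$. Let $2^{\omega}$ be the set of infinite words on $\{0,1\}$, with the product topology (Cantor space) and the lexicographic total order: $w_1<w_2$ iff there are a finite word $m$ and infinite words $w_1',w_2'$ with $w_1=m0w_1'$ and $w_2=m1w_2'$. For a coherence space $A$, the coherence space $\mathrm{flag}\,A$ is defined as follows. Its web is the set of continuous functions from $2^\omega$ to $|A|$, where $|A|$ has the discrete topology. Two functions $f,g$ in this web are strictly coherent, $f\frown g\,[\mathrm{flag}\,A]$, iff there exists $w\in 2^\omega$ such that $f(w)\frown g(w)\,[A]$ and $f(w')=g(w')$ for all $w'<w$. -}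

module Defs where

open import Level using (Level; _⊔_) renaming (suc to lsuc)
open import Data.Bool.Base using (Bool; true; false)
open import Data.List.Base using (List; foldr)
open import Data.List.Relation.Unary.All using (All)
open import Data.Nat.Base using (ℕ; zero; suc)
open import Data.Product.Base using (Σ; ∃; _×_; _,_; proj₁; proj₂)
open import Data.Sum.Base using (_⊎_; inj₁; inj₂)
open import Function.Base using (_∘_)
open import Function.Bundles using (Func; _⇔_; mk⇔)
open import Relation.Binary.Bundles using (Setoid)
open import Relation.Binary.Core using (Rel)
open import Relation.Binary.Definitions using (Reflexive; Symmetric; Irreflexive; _Respects_; _Respects₂_)
open import Relation.Binary.PropositionalEquality using (_≡_; subst; _→-setoid_)
open import Relation.Nullary.Negation using (¬_; contradiction)
open import Relation.Unary using (Pred)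

private
  variable
    c ℓ r r′ : Level

-- The web is a setoid because the web of flag A consists of functions,
-- whose equality is pointwise.

record CoherenceSpace (c ℓ r : Level) : Set (lsuc (c ⊔ ℓ ⊔ r)) where
  infix 4 _∼_ _⌢_
  field
    web     : Setoid c ℓ
  open Setoid web public using (_≈_) renaming (Carrier to Token)
  field
    _∼_     : Rel Token r
    ∼-resp  : _∼_ Respects₂ _≈_
    ∼-refl  : Reflexive _∼_
    ∼-sym   : Symmetric _∼_

  _⌢_ : Rel Token (ℓ ⊔ r)
  α ⌢ β = α ∼ β × ¬ (α ≈ β)

infix 4 _≣_

_≣_ : CoherenceSpace c ℓ r → CoherenceSpace c ℓ r′ → Set (lsuc (c ⊔ ℓ) ⊔ r ⊔ r′)
A ≣ B = Σ (A.web ≡ B.web) λ e →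
  let toB = subst Setoid.Carrier e in
  ∀ (α β : A.Token) → (α A.∼ β) ⇔ (toB α B.∼ toB β)
  where
  module A = CoherenceSpace A
  module B = CoherenceSpace B

module _ (W : Setoid c ℓ) where
  private module W = Setoid W

  fromStrict : (_S_ : Rel W.Carrier r) → _S_ Respects₂ W._≈_ →
               Irreflexive W._≈_ _S_ → Symmetric _S_ →
               CoherenceSpace c ℓ (ℓ ⊔ r)
  fromStrict _S_ resp irr sym = record
    { web    = W
    ; _∼_    = λ α β → (α W.≈ β) ⊎ (α S β)
    ; ∼-resp = (λ { y≈z (inj₁ x≈y) → inj₁ (W.trans x≈y y≈z)
                  ; y≈z (inj₂ xSy) → inj₂ (proj₁ resp y≈z xSy) })
             , (λ { y≈z (inj₁ y≈x) → inj₁ (W.trans (W.sym y≈z) y≈x)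
                  ; y≈z (inj₂ ySx) → inj₂ (proj₂ resp y≈z ySx) })
    ; ∼-refl = inj₁ W.refl
    ; ∼-sym  = λ { (inj₁ x≈y) → inj₁ (W.sym x≈y)
                 ; (inj₂ xSy) → inj₂ (sym xSy) }
    }

  fromStrict-⌢ : (_S_ : Rel W.Carrier r) (resp : _S_ Respects₂ W._≈_)
                 (irr : Irreflexive W._≈_ _S_) (sym : Symmetric _S_) →
                 let open CoherenceSpace (fromStrict _S_ resp irr sym) using (_⌢_) in
                 ∀ α β → (α ⌢ β) ⇔ (α S β)
  fromStrict-⌢ _S_ resp irr sym α β = mk⇔
    (λ { (inj₁ α≈β , α≉β) → contradiction α≈β α≉β
       ; (inj₂ αSβ , _)   → αSβ })
    (λ αSβ → inj₂ αSβ , λ α≈β → irr α≈β αSβ)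

infix 8 _⊥ᶜ

_⊥ᶜ : CoherenceSpace c ℓ r → CoherenceSpace c ℓ (ℓ ⊔ r)
A ⊥ᶜ = record
  { web    = web
  ; _∼_    = λ α β → (α ≈ β) ⊎ (¬ (α ∼ β))
  ; ∼-resp = (λ { y≈z (inj₁ x≈y) → inj₁ (W.trans x≈y y≈z)
                ; y≈z (inj₂ x≁y) → inj₂ (x≁y ∘ proj₁ ∼-resp (W.sym y≈z)) })
           , (λ { y≈z (inj₁ y≈x) → inj₁ (W.trans (W.sym y≈z) y≈x)
                ; y≈z (inj₂ y≁x) → inj₂ (y≁x ∘ proj₂ ∼-resp (W.sym y≈z)) })
  ; ∼-refl = inj₁ W.refl
  ; ∼-sym  = λ { (inj₁ x≈y) → inj₁ (W.sym x≈y)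
               ; (inj₂ x≁y) → inj₂ (x≁y ∘ ∼-sym) }
  }
  where
  open CoherenceSpace A
  module W = Setoid web

2^ω : Setoid _ _
2^ω = ℕ →-setoid Bool

open Setoid 2^ω public using () renaming (Carrier to Word; _≈_ to _≐_)

infixr 5 _◁_ _◁*_

_◁_ : Bool → Word → Word
(b ◁ w) zero    = b
(b ◁ w) (suc n) = w n

_◁*_ : List Bool → Word → Word
m ◁* w = foldr _◁_ w m

infix 4 _<ˡᵉˣ_

_<ˡᵉˣ_ : Rel Word _
w₁ <ˡᵉˣ w₂ = Σ (List Bool) λ m → Σ Word λ w₁′ → Σ Word λ w₂′ →
  (w₁ ≐ m ◁* false ◁ w₁′) × (w₂ ≐ m ◁* true ◁ w₂′)

-- Openness in the product topology on 2^ω: around each of its points U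
-- contains a basic open set, given by fixing finitely many coordinates.

IsOpen : Pred Word ℓ → Set ℓ
IsOpen U = ∀ w → U w → Σ (List ℕ) λ F →
  ∀ w′ → All (λ i → w i ≡ w′ i) F → U w′

-- Every subset V of the discrete space W is open; subsets of a setoid are the
-- predicates that respect its equality.  Level ℓ suffices for V, as it covers
-- the singletons.

Continuous : (W : Setoid c ℓ) → Func 2^ω W → Set (c ⊔ lsuc ℓ)
Continuous {ℓ = ℓ} W f =
  ∀ (V : Pred (Setoid.Carrier W) ℓ) → V Respects (Setoid._≈_ W) → IsOpen (V ∘ Func.to f)

record ContinuousMap (W : Setoid c ℓ) : Set (c ⊔ lsuc ℓ) where
  field
    func       : Func 2^ω W
    continuous : Continuous W func
  open Func func public using (to; cong)

open ContinuousMap using (to)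

C[2^ω,_] : Setoid c ℓ → Setoid (c ⊔ lsuc ℓ) ℓ
C[2^ω, W ] = record
  { Carrier       = ContinuousMap W
  ; _≈_           = λ f g → ∀ w → to f w W.≈ to g w
  ; isEquivalence = record
    { refl  = λ w → W.refl
    ; sym   = λ f≈g w → W.sym (f≈g w)
    ; trans = λ f≈g g≈h w → W.trans (f≈g w) (g≈h w)
    }
  }
  where module W = Setoid W

module _ (A : CoherenceSpace c ℓ r) where
  open CoherenceSpace A
  private
    module W = Setoid web
    module C = Setoid C[2^ω, web ]

  FlagStrict : Rel (ContinuousMap web) (ℓ ⊔ r)
  FlagStrict f g = ∃ λ (w : Word) →
    (to f w ⌢ to g w) × (∀ w′ → w′ <ˡᵉˣ w → to f w′ ≈ to g w′)

  flagStrict-sym : Symmetric FlagStrict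
  flagStrict-sym (w , (f∼g , f≉g) , eq) =
    w , (∼-sym f∼g , f≉g ∘ W.sym) , λ w′ w′<w → W.sym (eq w′ w′<w)

  flagStrict-irrefl : Irreflexive C._≈_ FlagStrict
  flagStrict-irrefl f≈g (w , (_ , f≉g) , _) = f≉g (f≈g w)

  flagStrict-respʳ : ∀ {f g h} → g C.≈ h → FlagStrict f g → FlagStrict f h
  flagStrict-respʳ g≈h (w , (f∼g , f≉g) , eq) =
    w , (proj₁ ∼-resp (g≈h w) f∼g , λ f≈h → f≉g (W.trans f≈h (W.sym (g≈h w))))
      , λ w′ w′<w → W.trans (eq w′ w′<w) (g≈h w′)

  flagStrict-resp : FlagStrict Respects₂ C._≈_
  flagStrict-resp =
      (λ {f} {g} {h} → flagStrict-respʳ {f} {g} {h})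
    , (λ {f} {g} {h} g≈h s →
         flagStrict-sym {f} {h} (flagStrict-respʳ {f} {g} {h} g≈h (flagStrict-sym {g} {f} s)))

  flag : CoherenceSpace (c ⊔ lsuc ℓ) ℓ (ℓ ⊔ r)
  flag = fromStrict C[2^ω, web ] FlagStrict
    flagStrict-resp
    (λ {f} {g} → flagStrict-irrefl {f} {g})
    (λ {f} {g} → flagStrict-sym {f} {g})

{-# OPTIONS --safe #-}
-- The set where two continuous maps f and g into a discrete space differ is
-- closed, so if it is inhabited it has a lexicographic minimum w, built greedily:
-- choose the bit 0 whenever some point of the set extends the prefix 0.
-- A minimal difference point is the only possible witness of strict coherence in
-- flag A or in flag (A ⊥ᶜ), and it witnesses exactly one of the two.
module Submission where

open import Defs
open import Level using (Level; _⊔_; Lift; lift; lower)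
open import Axiom.ExcludedMiddle using (ExcludedMiddle)
open import Data.Bool.Base using (Bool; true; false)
open import Data.Bool.Properties using (_≟_)
open import Data.List.Base using ([]; _∷_; _++_)
open import Data.List.Extrema.Nat using (max; xs≤max)
open import Data.List.Relation.Unary.All as All using (All)
open import Data.List.Relation.Unary.All.Properties using (++⁻)
open import Data.Nat.Base using (zero; suc; _<_; s≤s)
open import Data.Product.Base using (∃; _×_; _,_; proj₁; proj₂)
open import Data.Sum.Base as Sum using (_⊎_; inj₁; inj₂; [_,_])
open import Function.Base using (_∘_)
open import Function.Bundles using (mk⇔)
open import Relation.Binary.Bundles using (Setoid)
open import Relation.Binary.Definitions using (_Respects_)
open import Relation.Binary.PropositionalEquality using (_≡_; _≢_; refl; sym; trans)
open import Relation.Nullary.Decidable using (yes; no; map′; decidable-stable)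
open import Relation.Nullary.Negation using (¬_; contradiction)
open import Relation.Unary using (Pred; ∁)

open ContinuousMap using (to; cong; continuous)

private
  variable
    c ℓ r : Level

-- Membership in the difference set of two maps is a statement at level `ℓ`, whatever the level `r`
-- of coherence.
lower-em : ∀ r → ExcludedMiddle (ℓ ⊔ r) → ExcludedMiddle ℓ
lower-em r em {P} = map′ lower lift (em {Lift r P})

tail : Word → Word
tail w = w ∘ suc

◁-cong : ∀ b {v w} → v ≐ w → b ◁ v ≐ b ◁ w
◁-cong b v≐w zero    = refl
◁-cong b v≐w (suc n) = v≐w n

◁-η : ∀ {b} w → w 0 ≡ b → w ≐ b ◁ tail w
◁-η w w₀≡b zero    = w₀≡b
◁-η w w₀≡b (suc n) = refl

<ˡᵉˣ-cons : ∀ v w → v 0 ≡ w 0 → tail v <ˡᵉˣ tail w → v <ˡᵉˣ w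
<ˡᵉˣ-cons v w v₀≡w₀ (m , v′ , w′ , v≐ , w≐) =
  w 0 ∷ m , v′ , w′ ,
  (λ { zero → v₀≡w₀ ; (suc n) → v≐ n }) ,
  (λ { zero → refl  ; (suc n) → w≐ n })

-- The index `n` need not be the first difference: the recursion stops at the earliest one, whose
-- position gives the common prefix.
differ⇒<ˡᵉˣ⊎> : ∀ n v w → v n ≢ w n → v <ˡᵉˣ w ⊎ w <ˡᵉˣ v
differ⇒<ˡᵉˣ⊎> zero v w v₀≢w₀ with v 0 in v₀ | w 0 in w₀
... | false | false = contradiction refl v₀≢w₀
... | true  | true  = contradiction refl v₀≢w₀
... | false | true  = inj₁ ([] , tail v , tail w , ◁-η v v₀ , ◁-η w w₀)
... | true  | false = inj₂ ([] , tail w , tail v , ◁-η w w₀ , ◁-η v v₀)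
differ⇒<ˡᵉˣ⊎> (suc n) v w vₙ≢wₙ with v 0 ≟ w 0
... | no  v₀≢w₀ = differ⇒<ˡᵉˣ⊎> zero v w v₀≢w₀
... | yes v₀≡w₀ = Sum.map (<ˡᵉˣ-cons v w v₀≡w₀) (<ˡᵉˣ-cons w v (sym v₀≡w₀))
                    (differ⇒<ˡᵉˣ⊎> n (tail v) (tail w) vₙ≢wₙ)

<ˡᵉˣ-connex : ∀ {v w} → ¬ v <ˡᵉˣ w → ¬ w <ˡᵉˣ v → v ≐ w
<ˡᵉˣ-connex {v} {w} v≮w w≮v n =
  decidable-stable (v n ≟ w n) ([ v≮w , w≮v ] ∘ differ⇒<ˡᵉˣ⊎> n v w)

module LexMinimum (em : ExcludedMiddle ℓ) where

  leastBit : Pred Word ℓ → Bool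
  leastBit D with em {∃ λ w → D (false ◁ w)}
  ... | yes _ = false
  ... | no  _ = true

  -- The predicate varies along the recursion: it holds the tails of those points of `D` that extend
  -- the bits chosen so far.
  least : Pred Word ℓ → Word
  least D zero    = leastBit D
  least D (suc n) = least (D ∘ (leastBit D ◁_)) n

  ◁-respects : ∀ b {D : Pred Word ℓ} → D Respects _≐_ → (D ∘ (b ◁_)) Respects _≐_
  ◁-respects b resp v≐w = resp (◁-cong b v≐w)

  leastBit-true : ∀ D → leastBit D ≡ true → ∀ w → ¬ D (false ◁ w)
  leastBit-true D eq w Dw with em {∃ λ w → D (false ◁ w)}
  leastBit-true D () w Dw | yes _
  leastBit-true D eq w Dw | no ∄w = ∄w (w , Dw)

  leastBit-inhabited : ∀ D → D Respects _≐_ → ∃ D → ∃ (D ∘ (leastBit D ◁_))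
  leastBit-inhabited D resp (w , Dw) with em {∃ λ w → D (false ◁ w)}
  ... | yes ∃w = ∃w
  ... | no  ∄w with w 0 in w₀
  ...   | false = contradiction (tail w , resp (◁-η w w₀) Dw) ∄w
  ...   | true  = tail w , resp (◁-η w w₀) Dw

  -- Induction on the common prefix `m`. At its end the greedy bit is 1, so nothing in `D` starts
  -- with 0; before that, `w` shares the greedy bit and its tail falls into the next residual set.
  least-minimal-at : ∀ D → D Respects _≐_ → ∀ m w {w′ l′} → w ≐ m ◁* false ◁ w′ →
                     least D ≐ m ◁* true ◁ l′ → ¬ D w
  least-minimal-at D resp [] w {w′} w≐ l≐ Dw =
    leastBit-true D (l≐ 0) w′ (resp w≐ Dw)
  least-minimal-at D resp (b ∷ m) w w≐ l≐ Dw =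
    least-minimal-at (D ∘ (leastBit D ◁_)) (◁-respects (leastBit D) resp) m (tail w)
      (w≐ ∘ suc) (l≐ ∘ suc)
      (resp (◁-η w (trans (w≐ 0) (sym (l≐ 0)))) Dw)

  least-minimal : ∀ D → D Respects _≐_ → ∀ w → w <ˡᵉˣ least D → ¬ D w
  least-minimal D resp w (m , _ , _ , w≐ , l≐) = least-minimal-at D resp m w w≐ l≐

  least-approximable : ∀ D → D Respects _≐_ → ∃ D → ∀ n →
                       ∃ λ w → D w × (∀ {i} → i < n → least D i ≡ w i)
  least-approximable D resp (w , Dw) zero    = w , Dw , λ ()
  least-approximable D resp ∃D       (suc n)
    with w , Dw , agree ← least-approximable (D ∘ (leastBit D ◁_))
           (◁-respects (leastBit D) resp) (leastBit-inhabited D resp ∃D) n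
    = leastBit D ◁ w , Dw , λ { {zero} _ → refl ; {suc i} (s≤s i<n) → agree i<n }

  least-member : ∀ D → D Respects _≐_ → IsOpen (∁ D) → ∃ D → D (least D)
  least-member D resp ∁D-open ∃D = decidable-stable em λ least∉D →
    let F , F⇒∁D       = ∁D-open (least D) least∉D
        -- `suc` makes the bound exceed every coordinate in `F`, so this point of `D` lies in the
        -- basic open set around `least D` that avoids `D`.
        w , Dw , agree = least-approximable D resp ∃D (suc (max 0 F))
    in F⇒∁D w (All.map (agree ∘ s≤s) (xs≤max 0 F)) Dw

module _ (W : Setoid c ℓ) (f g : ContinuousMap W) where
  private module W = Setoid W

  Differ : Pred Word ℓ
  Differ w = ¬ (to f w W.≈ to g w)

  Differ-respects : Differ Respects _≐_
  Differ-respects v≐w fv≉gv fw≈gw =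
    fv≉gv (W.trans (cong f v≐w) (W.trans fw≈gw (W.sym (cong g v≐w))))

  Differ-closed : IsOpen (∁ Differ)
  Differ-closed w ¬¬fw≈gw =
    let F , F⇒f = locallyConstant f
        G , G⇒g = locallyConstant g
    in F ++ G , λ w′ agree fw′≉gw′ →
         let agreeF , agreeG = ++⁻ F agree
         -- The goal is absurdity, so the double negation can be removed without excluded middle.
         in ¬¬fw≈gw λ fw≈gw →
              fw′≉gw′ (W.trans (F⇒f w′ agreeF) (W.trans fw≈gw (W.sym (G⇒g w′ agreeG))))
    where
    locallyConstant : (h : ContinuousMap W) → ∃ λ F →
                      ∀ w′ → All (λ i → w i ≡ w′ i) F → to h w′ W.≈ to h w
    locallyConstant h =
      -- The equality class of `to h w` is a singleton of the discrete space, hence its preimage is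
      -- open.
      continuous h (W._≈ to h w) (λ x≈y x≈hw → W.trans (W.sym x≈y) x≈hw) w W.refl

  FirstDifference : Pred Word ℓ
  FirstDifference w = Differ w × (∀ w′ → w′ <ˡᵉˣ w → to f w′ W.≈ to g w′)

  -- Neither word precedes the other, as the maps agree strictly below each of them.
  firstDifference-unique : ∀ {v w} → FirstDifference v → FirstDifference w → v ≐ w
  firstDifference-unique {v} {w} (fv≉gv , below-v) (fw≉gw , below-w) =
    <ˡᵉˣ-connex (fv≉gv ∘ below-w v) (fw≉gw ∘ below-v w)

  ≈⊎firstDifference : ExcludedMiddle ℓ → (∀ w → to f w W.≈ to g w) ⊎ ∃ FirstDifference
  ≈⊎firstDifference em with em {∃ Differ}
  ... | no  ∄w = inj₁ λ w → decidable-stable em λ fw≉gw → ∄w (w , fw≉gw)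
  ... | yes ∃w = inj₂ (least Differ
                      , least-member Differ Differ-respects Differ-closed ∃w
                      , λ w′ w′<l → decidable-stable em
                          (least-minimal Differ Differ-respects w′ w′<l))
    where open LexMinimum em

module _ (A : CoherenceSpace c ℓ r) (f g : ContinuousMap (CoherenceSpace.web A)) where
  open CoherenceSpace A

  -- Both witnesses are first differences, hence the same word, where the two values would be both
  -- coherent and incoherent in `A`.
  flagStrict-disjoint : FlagStrict A f g → ¬ FlagStrict (A ⊥ᶜ) f g
  flagStrict-disjoint _ (w , (inj₁ fw≈gw , fw≉gw) , _) = fw≉gw fw≈gw
  flagStrict-disjoint (v , (fv∼gv , fv≉gv) , below-v) (w , (inj₂ fw≁gw , fw≉gw) , below-w) =
    fw≁gw (proj₁ ∼-resp (cong g v≐w) (proj₂ ∼-resp (cong f v≐w) fv∼gv))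
    where
    v≐w : v ≐ w
    v≐w = firstDifference-unique web f g (fv≉gv , below-v) (fw≉gw , below-w)

  firstDifference⇒flagStrict-⊥ᶜ : ∃ (FirstDifference web f g) → ¬ FlagStrict A f g →
                                  FlagStrict (A ⊥ᶜ) f g
  firstDifference⇒flagStrict-⊥ᶜ (w , fw≉gw , below) ¬strict =
    w , (inj₂ (λ fw∼gw → ¬strict (w , (fw∼gw , fw≉gw) , below)) , fw≉gw) , below

proposition16 : ∀ {c ℓ r : Level} → ExcludedMiddle (ℓ ⊔ r) →
    (A : CoherenceSpace c ℓ r) → (flag A) ⊥ᶜ ≣ flag (A ⊥ᶜ)
-- Both webs are `C[2^ω, web ]` by definition, so the transport along `refl` is the identity.
proposition16 {r = r} em A = refl , λ f g → mk⇔
  (λ { (inj₁ f≈g) → inj₁ f≈g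
     ; (inj₂ f≁g) → Sum.map₂
         (λ d → firstDifference⇒flagStrict-⊥ᶜ A f g d (f≁g ∘ inj₂))
         (≈⊎firstDifference web f g (lower-em r em)) })
  (λ { (inj₁ f≈g)    → inj₁ f≈g
     ; (inj₂ strict) → inj₂
         [ (λ f≈g → flagStrict-irrefl (A ⊥ᶜ) {f} {g} f≈g strict)
         , (λ strict′ → flagStrict-disjoint A f g strict′ strict) ] })
  where open CoherenceSpace A using (web)
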